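{- Let $\sigma\in S_3$ and $n\ge1$. The periodic points of the map $\operatorname{SC}_\sigma:S_n\to S_n$ are precisely the permutations in $S_n$ that avoid both $\sigma$ and $\operatorname{rev}(\sigma)$ consecutively. When $n\geq 2$, each of these periodic points has period $2$.
   Context: $S_n$ is the set of permutations of $[n]$ in one-line notation. Two sequences of distinct integers have the same relative order if replacing the $i$th smallest entry of each by $i$ yields the same word. A permutation $\tau$ contains $\sigma$ consecutively if some consecutive subsequence of $\tau$ has the same relative order as $\sigma$; otherwise it avoids $\sigma$ consecutively. For a set $\mathcal A$ of permutations, $T_{\mathcal A}:S_n\to S_n$ is defined by sending $\pi$ through a stack: at each step, if there is a next input entry and placing it on top of the stack would make the stack contents, read top to bottom, have the same relative order as some element of $\mathcal A$, push it; otherwise pop the top entry of the stack to the end of the output; stop when the output has length $n$. $\operatorname{SC}_\sigma=T_{\mathcal A}$ with $\mathcal A$ the set of permutations avoiding $\sigma$ consecutively. $\operatorname{rev}(\sigma_1\cdots\sigma_k)=\sigma_k\cdots\sigma_1$. A periodic point of $f:S_n\to S_n$ is $\pi$ with $f^t(\pi)=\pi$ for some $t\ge1$; its period is the least such $t$. -}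

module Defs where

open import Data.Nat using (ℕ; zero; suc; _≤_; _<_; _≤?_; _+_; _*_)
open import Data.Nat.Properties using (_≟_)
open import Data.List using (List; []; _∷_; _++_; [_]; length; take; map; upTo; filter; reverse)
open import Data.List.Properties using (≡-dec)
open import Data.List.Relation.Unary.Any using (Any; any?)
open import Data.List.Relation.Binary.Permutation.Propositional using (_↭_)
open import Data.Product using (_×_; Σ)
open import Relation.Nullary using (Dec; yes; no; ¬_)
open import Relation.Binary.PropositionalEquality using (_≡_)

-- Permutations are words (lists) of natural numbers in one-line notation.
-- S_n membership: π is a rearrangement of [1, 2, ..., n].
IsPerm : ℕ → List ℕ → Set
IsPerm n π = π ↭ map suc (upTo n)

-- Standardization: replace each entry by its rank (the i-th smallest entry
-- becomes i); on words of distinct entries this is the usual reduction.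
rank : List ℕ → ℕ → ℕ
rank xs x = length (filter (_≤? x) xs)

st : List ℕ → List ℕ
st xs = map (rank xs) xs

SameOrder : List ℕ → List ℕ → Set
SameOrder xs ys = st xs ≡ st ys

windows : ℕ → List ℕ → List (List ℕ)
windows zero    []       = [] ∷ []
windows (suc k) []       = []
windows k (x ∷ xs) with k ≤? length (x ∷ xs)
... | yes _ = take k (x ∷ xs) ∷ windows k xs
... | no  _ = []

ContainsConsec : List ℕ → List ℕ → Set
ContainsConsec σ τ = Any (λ w → SameOrder w σ) (windows (length σ) τ)

AvoidsConsec : List ℕ → List ℕ → Set
AvoidsConsec σ τ = ¬ ContainsConsec σ τ

containsConsec? : (σ τ : List ℕ) → Dec (ContainsConsec σ τ)
containsConsec? σ τ = any? (λ w → ≡-dec _≟_ (st w) (st σ)) (windows (length σ) τ)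

-- Membership in 𝒜 for SC_σ: the stack word w has the same relative order as
-- some permutation avoiding σ consecutively, i.e. its standardization st w
-- (the unique permutation with the same relative order) avoids σ.
InA : List ℕ → List ℕ → Set
InA σ w = AvoidsConsec σ (st w)

inA? : (σ w : List ℕ) → Dec (InA σ w)
inA? σ w with containsConsec? σ (st w)
... | yes c = no (λ f → f c)
... | no  c = yes c

-- Stack machine: fuel, target output length n, input, stack (head = top), output.
run : List ℕ → ℕ → ℕ → List ℕ → List ℕ → List ℕ → List ℕ
run σ zero       n inp stk out = out
run σ (suc fuel) n inp stk out with length out ≟ n
... | yes _ = out
... | no  _ = step inp stk
  where
  pop : List ℕ → List ℕ
  pop []        = out            -- cannot happen for the maps considered
  pop (s ∷ stk′) = run σ fuel n inp stk′ (out ++ [ s ])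
  step : List ℕ → List ℕ → List ℕ
  step []        stk′ = pop stk′
  step (x ∷ inp′) stk′ with inA? σ (x ∷ stk′)
  ... | yes _ = run σ fuel n inp′ (x ∷ stk′) out
  ... | no  _ = pop stk′

-- SC_σ applied to π (n = length π; 2n+1 steps suffice: n pushes, n pops).
SC : List ℕ → List ℕ → List ℕ
SC σ π = run σ (suc (2 * length π)) (length π) π [] []

rev : List ℕ → List ℕ
rev = reverse

iter : {A : Set} → (A → A) → ℕ → A → A
iter f zero    x = x
iter f (suc t) x = f (iter f t x)

Periodic : {A : Set} → (A → A) → A → Set
Periodic f π = Σ ℕ (λ t → (1 ≤ t) × (iter f t π ≡ π))

HasPeriod : {A : Set} → (A → A) → A → ℕ → Set
HasPeriod f π p = (1 ≤ p) × (iter f p π ≡ π) × ((t : ℕ) → 1 ≤ t → t < p → ¬ (iter f t π ≡ π))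

{-# OPTIONS --safe #-}

-- Let P x s t say that pushing x on a stack with top entries s, t creates σ at
-- the top; a premature pop then removes s from between x and t.  Say that a is
-- straddled by c and b if a relates to c and b as the middle entry of σ relates
-- to its neighbours (larger than both, smaller than both, or strictly between).
-- An extreme entry m of π, chosen to be never straddled, is never popped
-- prematurely.  Read π = reverse S · m · R outwards from m, and compare words by
-- the first difference, replacing a by b after c being an improvement if a is
-- straddled by c and b.  If SC π = reverse S′ · m · R′, then R′ improves S and S′
-- improves R, because each premature pop is such a replacement.  Along a cycle
-- there is no strict improvement, so SC reverses every permutation on it, and
-- SC π = reverse π exactly when reverse π avoids σ.

module Submission where

open import Defs
open import Data.Empty using (⊥; ⊥-elim)
open import Data.List using (List; []; _∷_; _++_; _ʳ++_; [_]; length; map; upTo; filter; reverse)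
open import Data.List.Properties
  using (≡-dec; ∷-injective; map-∘; map-cong; map-cong-local; reverse-map; reverse-injective;
         reverse-involutive; unfold-reverse; ʳ++-defn; ʳ++-ʳ++; ++-identityʳ; length-upTo; length-map;
         length-++; ++-assoc)
open import Data.List.Membership.Propositional using (_∈_)
open import Data.List.Membership.Propositional.Properties
  using (∈-∃++; ∈-++⁺ˡ; ∈-insert; ∈-map⁺; ∈-upTo⁺)
open import Data.List.Relation.Binary.Permutation.Propositional
  using (_↭_; ↭-refl; ↭-sym; ↭-trans; ↭-reflexive; prep; ↭⇒↭ₛ)
open import Data.List.Relation.Binary.Permutation.Propositional.Properties
  using (shift; ++⁺ʳ; ↭-length; ↭-reverse; filter-↭; ∈-resp-↭; All-resp-↭)
import Data.List.Relation.Binary.Permutation.Setoid.Properties as Permutationₛ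
open import Data.List.Relation.Unary.All using (All; []; _∷_; lookup; tabulate)
import Data.List.Relation.Unary.All.Properties as All
open import Data.List.Relation.Unary.AllPairs using ([]; _∷_)
open import Data.List.Relation.Unary.Any using (here; there)
open import Data.List.Relation.Unary.Any.Properties using (reverse⁻)
open import Data.List.Relation.Unary.Unique.Propositional using (Unique)
import Data.List.Relation.Unary.Unique.Propositional.Properties as Unique
open import Data.Nat using (ℕ; zero; suc; _+_; _*_; _≤_; _<_; _≤?_; z≤n; s≤s; s≤s⁻¹)
open import Data.Nat.Properties
  using (_≟_; suc-injective; ≤-refl; ≤-trans; <-trans; <-asym; <⇒≱; ≮⇒≥; ≰⇒>; <-cmp;
         m≤n⇒m≤1+n; +-suc; +-comm; +-cancelˡ-≡; +-identityʳ)
open import Data.Product using (_×_; _,_; proj₁; proj₂; ∃₂; ∃-syntax)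
open import Data.Sum using (_⊎_; inj₁; inj₂)
open import Function using (_∘_)
open import Function.Bundles using (_⇔_; mk⇔; Equivalence)
open import Relation.Binary.Definitions using (tri<; tri≈; tri>)
open import Relation.Binary.PropositionalEquality
  using (_≡_; _≢_; refl; sym; trans; cong; subst; subst₂; setoid)
open import Relation.Nullary using (Dec; yes; no; ¬_; contradiction)
open import Relation.Nullary.Decidable using (map′)
open import Relation.Unary using (Decidable)

private variable
  a b c d m n x y z s t : ℕ
  w w′ w″ u v inp stk o xs ys : List ℕ

-- Ranks and relative order

module _ {P Q : ℕ → Set} (P? : Decidable P) (Q? : Decidable Q) where

  length-filter-mono : (∀ {a} → P a → Q a) → ∀ xs →
    length (filter P? xs) ≤ length (filter Q? xs)
  length-filter-mono P⇒Q [] = z≤n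
  length-filter-mono P⇒Q (a ∷ xs) with P? a | Q? a
  ... | yes _  | yes _  = s≤s (length-filter-mono P⇒Q xs)
  ... | yes pa | no ¬qa = contradiction (P⇒Q pa) ¬qa
  ... | no _   | yes _  = m≤n⇒m≤1+n (length-filter-mono P⇒Q xs)
  ... | no _   | no _   = length-filter-mono P⇒Q xs

  length-filter-strict : (∀ {a} → P a → Q a) → ¬ P y → Q y → y ∈ xs →
    length (filter P? xs) < length (filter Q? xs)
  length-filter-strict {xs = a ∷ xs} P⇒Q ¬py qy y∈ with P? a | Q? a | y∈
  ... | yes pa | _      | here refl = contradiction pa ¬py
  ... | no _   | yes _  | here refl = s≤s (length-filter-mono P⇒Q xs)
  ... | no _   | no ¬qa | here refl = contradiction qy ¬qa
  ... | yes _  | yes _  | there y∈xs = s≤s (length-filter-strict P⇒Q ¬py qy y∈xs)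
  ... | yes pa | no ¬qa | there y∈xs = contradiction (P⇒Q pa) ¬qa
  ... | no _   | yes _  | there y∈xs = m≤n⇒m≤1+n (length-filter-strict P⇒Q ¬py qy y∈xs)
  ... | no _   | no _   | there y∈xs = length-filter-strict P⇒Q ¬py qy y∈xs

  length-filter-map : (f : ℕ → ℕ) → All (λ a → P (f a) ⇔ Q a) xs →
    length (filter P? (map f xs)) ≡ length (filter Q? xs)
  length-filter-map f [] = refl
  length-filter-map {a ∷ xs} f (p⇔q ∷ rest) with P? (f a) | Q? a
  ... | yes _  | yes _  = cong suc (length-filter-map f rest)
  ... | yes pa | no ¬qa = contradiction (Equivalence.to p⇔q pa) ¬qa
  ... | no ¬pa | yes qa = contradiction (Equivalence.from p⇔q qa) ¬pa
  ... | no _   | no _   = length-filter-map f rest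

rank-mono : ∀ xs → x ≤ y → rank xs x ≤ rank xs y
rank-mono xs x≤y = length-filter-mono (_≤? _) (_≤? _) (λ a≤x → ≤-trans a≤x x≤y) xs

rank-strict : y ∈ xs → x < y → rank xs x < rank xs y
rank-strict y∈xs x<y =
  length-filter-strict (_≤? _) (_≤? _) (λ a≤x → ≤-trans a≤x (≤-trans (m≤n⇒m≤1+n ≤-refl) x<y))
    (<⇒≱ x<y) ≤-refl y∈xs

-- If `y < x`, then `x` itself is counted in the rank of `x` but not in that of `y`. Hence ranking
-- embeds the order on the entries of a word, and standardization preserves containment both ways.
rank-≤-⇔ : x ∈ xs → rank xs x ≤ rank xs y ⇔ x ≤ y
rank-≤-⇔ {xs = xs} x∈xs =
  mk⇔ (λ r → ≮⇒≥ λ y<x → <⇒≱ (rank-strict x∈xs y<x) r) (rank-mono xs)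

rank-reflects-< : ∀ xs → rank xs x < rank xs y → x < y
rank-reflects-< xs r = ≰⇒> λ y≤x → <⇒≱ r (rank-mono xs y≤x)

rank-≡-reflects-< : ∀ xs ys → rank xs x ≡ rank ys a → rank xs y ≡ rank ys b →
  b ∈ ys → a < b → x < y
rank-≡-reflects-< xs ys eqa eqb b∈ys a<b =
  rank-reflects-< xs (subst₂ _<_ (sym eqa) (sym eqb) (rank-strict b∈ys a<b))

map-triple-≡ : ∀ (f g : ℕ → ℕ) →
  map f (x ∷ y ∷ z ∷ []) ≡ map g (a ∷ b ∷ c ∷ []) → f x ≡ g a × f y ≡ g b × f z ≡ g c
map-triple-≡ f g eq with ∷-injective eq
... | eqa , eq′ with ∷-injective eq′
...   | eqb , eq″ = eqa , eqb , proj₁ (∷-injective eq″)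

EmbedsOrderOn : (ℕ → ℕ) → List ℕ → Set
EmbedsOrderOn f xs = ∀ {a b} → a ∈ xs → b ∈ xs → f a ≤ f b ⇔ a ≤ b

st-map : ∀ {f} → EmbedsOrderOn f xs → st (map f xs) ≡ st xs
st-map {xs} {f} emb = trans (sym (map-∘ xs))
  (map-cong-local (tabulate λ b∈ →
    length-filter-map (_≤? _) (_≤? _) f (tabulate λ a∈ → emb a∈ b∈)))

st-reverse : ∀ xs → st (reverse xs) ≡ reverse (st xs)
st-reverse xs = trans
  (map-cong (λ x → ↭-length (filter-↭ (_≤? x) (↭-reverse xs))) (reverse xs))
  (reverse-map (rank xs) xs)

SameOrder-reverse : ∀ xs ys → SameOrder xs ys → SameOrder (reverse xs) (reverse ys)
SameOrder-reverse xs ys eq =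
  trans (st-reverse xs) (trans (cong reverse eq) (sym (st-reverse ys)))

-- Reversal and words without repetition.

head-∈-ʳ++ : ∀ xs → x ∷ w ≡ (y ∷ xs) ʳ++ stk → x ∈ y ∷ xs
head-∈-ʳ++ {y = y} xs eq with reverse (y ∷ xs) in rev-eq | trans eq (ʳ++-defn (y ∷ xs))
... | []     | _    = contradiction (reverse-injective {x = y ∷ xs} {y = []} rev-eq) λ ()
... | h ∷ hs | refl = reverse⁻ (subst (h ∈_) (sym rev-eq) (here refl))

ʳ++-↭ : ∀ xs → xs ʳ++ ys ↭ xs ++ ys
ʳ++-↭ {ys} xs = ↭-trans (↭-reflexive (ʳ++-defn xs)) (++⁺ʳ ys (↭-reverse xs))

Unique-resp-↭ : xs ↭ ys → Unique xs → Unique ys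
Unique-resp-↭ p = Permutationₛ.Unique-resp-↭ (setoid ℕ) (↭⇒↭ₛ p)

Unique-head : Unique (x ∷ xs) → ¬ x ∈ xs
Unique-head (x≢ ∷ _) x∈xs = lookup x≢ x∈xs refl

Unique-tail : Unique (x ∷ xs) → Unique xs
Unique-tail (_ ∷ u) = u

++-∷-unique : ∀ xs ys → Unique (xs ++ m ∷ u) → xs ++ m ∷ u ≡ ys ++ m ∷ v → xs ≡ ys × u ≡ v
++-∷-unique [] [] uniq refl = refl , refl
++-∷-unique [] (_ ∷ ys) uniq refl = contradiction (∈-insert ys) (Unique-head uniq)
++-∷-unique (_ ∷ xs) [] uniq refl = contradiction (∈-insert xs) (Unique-head uniq)
++-∷-unique (_ ∷ xs) (_ ∷ ys) uniq eq with ∷-injective eq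
... | refl , eq′ with ++-∷-unique xs ys (Unique-tail uniq) eq′
...   | refl , refl = refl , refl

ʳ++-∷-unique : ∀ xs ys → Unique (xs ʳ++ m ∷ u) → xs ʳ++ m ∷ u ≡ ys ʳ++ m ∷ v → xs ≡ ys × u ≡ v
ʳ++-∷-unique xs ys uniq eq
  with ++-∷-unique (reverse xs) (reverse ys) (subst Unique (ʳ++-defn xs) uniq)
         (trans (sym (ʳ++-defn xs)) (trans eq (ʳ++-defn ys)))
... | eqˡ , eqʳ = reverse-injective eqˡ , eqʳ

reverse-ʳ++-∷ : ∀ xs ys → reverse (xs ʳ++ m ∷ ys) ≡ ys ʳ++ m ∷ xs
reverse-ʳ++-∷ xs ys = trans (ʳ++-ʳ++ xs) (cong (λ zs → ys ʳ++ _ ∷ zs) (++-identityʳ xs))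

-- Stack sorting as a transition relation

module _ (P : ℕ → ℕ → ℕ → Set) where

  Blocked : ℕ → List ℕ → Set
  Blocked x (s ∷ t ∷ _) = P x s t
  Blocked x _           = ⊥

  -- The third index is the output still to come, so no accumulator is carried. `done` releases the
  -- whole stack at once, since without input it is popped from top to bottom; `pop` is therefore
  -- always a premature pop.
  data Sorts : List ℕ → List ℕ → List ℕ → Set where
    done : Sorts [] stk stk
    push : ¬ Blocked x stk → Sorts inp (x ∷ stk) o → Sorts (x ∷ inp) stk o
    pop  : P x s t → Sorts (x ∷ inp) (t ∷ stk) o → Sorts (x ∷ inp) (s ∷ t ∷ stk) (s ∷ o)

  blocked-shape : ∀ stk → Blocked x stk → ∃[ s ] ∃[ t ] ∃[ u ] stk ≡ s ∷ t ∷ u × P x s t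
  blocked-shape (s ∷ t ∷ u) b = s , t , u , refl , b

Sorts-↭ : ∀ {P} → Sorts P inp stk o → o ↭ inp ++ stk
Sorts-↭ done = ↭-refl
Sorts-↭ (push {x} {stk} {inp} _ r) = ↭-trans (Sorts-↭ r) (shift x inp stk)
Sorts-↭ (pop {x = x} {s} {t} {inp} {stk} _ r) =
  ↭-trans (prep s (Sorts-↭ r)) (↭-sym (shift s (x ∷ inp) (t ∷ stk)))

map-↭ : ∀ {P} (f : List ℕ → List ℕ) → (∀ π → Sorts P π [] (f π)) → ∀ π → f π ↭ π
map-↭ f f-sorts π = ↭-trans (Sorts-↭ (f-sorts π)) (↭-reflexive (++-identityʳ π))

-- The stack machine for one pattern of length 3.

module Pattern (p q r : ℕ) where

  σ : List ℕ
  σ = p ∷ q ∷ r ∷ []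

  -- A record, so that x, s and t can be inferred from P x s t.
  record P (x s t : ℕ) : Set where
    constructor pattern-at
    field sameOrder : SameOrder (x ∷ s ∷ t ∷ []) σ

  open P public

  contains-∷ : ∀ w → ContainsConsec σ w → ContainsConsec σ (x ∷ w)
  contains-∷ (_ ∷ _ ∷ _ ∷ _) c = there c

  contains-∷⁻ : ∀ w → ContainsConsec σ (x ∷ w) → Blocked P x w ⊎ ContainsConsec σ w
  contains-∷⁻ (_ ∷ _ ∷ _) (here eq) = inj₁ (pattern-at eq)
  contains-∷⁻ (_ ∷ _ ∷ _) (there c) = inj₂ c

  blocked⇒contains : ∀ w → Blocked P x w → ContainsConsec σ (x ∷ w)
  blocked⇒contains (_ ∷ _ ∷ _) b = here (sameOrder b)

  contains-ʳ++ : ∀ xs → ContainsConsec σ w → ContainsConsec σ (xs ʳ++ w)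
  contains-ʳ++ [] c = c
  contains-ʳ++ {w} (x ∷ xs) c = contains-ʳ++ xs (contains-∷ w c)

  module _ {f : ℕ → ℕ} where

    contains-map⁻ : ∀ w → EmbedsOrderOn f w → ContainsConsec σ (map f w) → ContainsConsec σ w
    contains-map⁻ (x ∷ y ∷ z ∷ w) emb (here eq) =
      here (trans (sym (st-map (λ a∈ b∈ → emb (∈-++⁺ˡ a∈) (∈-++⁺ˡ b∈)))) eq)
    contains-map⁻ (x ∷ w@(_ ∷ _ ∷ _)) emb (there c) =
      there (contains-map⁻ w (λ a∈ b∈ → emb (there a∈) (there b∈)) c)

    contains-map⁺ : ∀ w → EmbedsOrderOn f w → ContainsConsec σ w → ContainsConsec σ (map f w)
    contains-map⁺ (x ∷ y ∷ z ∷ w) emb (here eq) =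
      here (trans (st-map {xs = x ∷ y ∷ z ∷ []} (λ a∈ b∈ → emb (∈-++⁺ˡ a∈) (∈-++⁺ˡ b∈))) eq)
    contains-map⁺ (x ∷ w@(_ ∷ _ ∷ _)) emb (there c) =
      there (contains-map⁺ w (λ a∈ b∈ → emb (there a∈) (there b∈)) c)

  InA⇒avoids : ∀ w → InA σ w → AvoidsConsec σ w
  InA⇒avoids w avoids = avoids ∘ contains-map⁺ w (λ a∈ _ → rank-≤-⇔ a∈)

  avoids⇒InA : ∀ w → AvoidsConsec σ w → InA σ w
  avoids⇒InA w avoids = avoids ∘ contains-map⁻ w (λ a∈ _ → rank-≤-⇔ a∈)

  Blocked? : ∀ x w → Dec (Blocked P x w)
  Blocked? x []          = no λ ()
  Blocked? x (_ ∷ [])    = no λ ()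
  Blocked? x (_ ∷ _ ∷ _) = map′ pattern-at sameOrder (≡-dec _≟_ _ _)

  InA⇒¬blocked : InA σ (x ∷ stk) → ¬ Blocked P x stk
  InA⇒¬blocked {stk = stk} inA = InA⇒avoids _ inA ∘ blocked⇒contains stk

  -- As the stack avoids `σ`, an occurrence after the push must be the topmost window. This makes
  -- the test of the machine local.
  ¬InA⇒blocked : AvoidsConsec σ stk → ¬ InA σ (x ∷ stk) → Blocked P x stk
  ¬InA⇒blocked {stk} {x} avoids ¬inA with Blocked? x stk
  ... | yes b = b
  ... | no ¬b = contradiction (avoids⇒InA (x ∷ stk) (avoids′ ∘ contains-∷⁻ stk)) ¬inA
    where
    avoids′ : ¬ (Blocked P x stk ⊎ ContainsConsec σ stk)
    avoids′ (inj₁ b) = ¬b b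
    avoids′ (inj₂ c) = avoids c

  private
    length-pop : ∀ out i k → length out + (i + suc k) ≡ n → length (out ++ [ s ]) + (i + k) ≡ n
    length-pop {s = s} out i k refl
      rewrite length-++ out {[ s ]} | +-suc i k | +-suc (length out) (i + k)
            | +-comm (length out) 1 = refl

    fuel-pop : ∀ {fuel} i k → i + (i + suc k) < suc fuel → i + (i + k) < fuel
    fuel-pop i k enough rewrite +-suc i k | +-suc i (i + k) = s≤s⁻¹ enough

    fuel-push : ∀ {fuel} i k → suc i + (suc i + k) < suc fuel → i + (i + suc k) < fuel
    fuel-push i k enough rewrite +-suc i k = s≤s⁻¹ enough

  -- The three invariants: the stack avoids `σ`; no entry is lost, so the stopping test succeeds
  -- exactly when input and stack are empty; and the fuel covers a push and a pop for each input
  -- entry and a pop for each stacked one.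
  run-sorts : ∀ fuel n inp stk out → AvoidsConsec σ stk →
    length out + (length inp + length stk) ≡ n →
    length inp + (length inp + length stk) < fuel →
    ∃[ o ] Sorts P inp stk o × run σ fuel n inp stk out ≡ out ++ o
  run-sorts (suc fuel) n inp stk out avoids total enough with length out ≟ n
  run-sorts (suc fuel) n [] [] out avoids total enough | yes _ = [] , done , sym (++-identityʳ out)
  run-sorts (suc fuel) n [] (s ∷ stk) out avoids total enough | yes refl =
    contradiction (+-cancelˡ-≡ (length out) _ 0 (trans total (sym (+-identityʳ _)))) λ ()
  run-sorts (suc fuel) n (x ∷ inp) stk out avoids total enough | yes refl =
    contradiction (+-cancelˡ-≡ (length out) _ 0 (trans total (sym (+-identityʳ _)))) λ ()
  run-sorts (suc fuel) n [] [] out avoids total enough | no ¬end =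
    contradiction (trans (sym (+-identityʳ _)) total) ¬end
  run-sorts (suc fuel) n [] (s ∷ stk) out avoids total enough | no _
    with run-sorts fuel n [] stk (out ++ [ s ]) (avoids ∘ contains-∷ stk)
           (length-pop out 0 (length stk) total) (fuel-pop 0 (length stk) enough)
  ... | _ , done , eq = s ∷ stk , done , trans eq (++-assoc out [ s ] stk)
  run-sorts (suc fuel) n (x ∷ inp) stk out avoids total enough | no _ with inA? σ (x ∷ stk)
  run-sorts (suc fuel) n (x ∷ inp) stk out avoids total enough | no _ | yes inA
    with run-sorts fuel n inp (x ∷ stk) out (InA⇒avoids (x ∷ stk) inA)
           (trans (cong (length out +_) (+-suc (length inp) (length stk))) total)
           (fuel-push (length inp) (length stk) enough)
  ... | o , r , eq = o , push (InA⇒¬blocked inA) r , eq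
  run-sorts (suc fuel) n (x ∷ inp) stk out avoids total enough | no _ | no ¬inA
    -- A forbidden push needs two entries on the stack, so the pop leaves `t` behind.
    with blocked-shape P {x} stk (¬InA⇒blocked avoids ¬inA)
  ... | s , t , stk , refl , b
    with run-sorts fuel n (x ∷ inp) (t ∷ stk) (out ++ [ s ]) (avoids ∘ contains-∷ (t ∷ stk))
           (length-pop out (suc (length inp)) (suc (length stk)) total)
           (fuel-pop (suc (length inp)) (suc (length stk)) enough)
  ...   | o , r , eq = s ∷ o , pop b r , trans eq (++-assoc out [ s ] o)

  SC-sorts : ∀ π → Sorts P π [] (SC σ π)
  SC-sorts π
    -- `2 * length π` unfolds to the fuel measure of the initial state, so `≤-refl` suffices.
    with run-sorts (suc (2 * length π)) (length π) π [] [] (λ ()) (+-identityʳ _) ≤-refl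
  ... | o , r , eq = subst (Sorts P π []) (sym eq) r

  -- `inp ʳ++ stk` is the stack reached by pushing everything. A premature pop would find `x`, `s`,
  -- `t` consecutive in it, forming `σ`.
  sorts-avoiding : AvoidsConsec σ (inp ʳ++ stk) → Sorts P inp stk o → o ≡ inp ʳ++ stk
  sorts-avoiding avoids done = refl
  sorts-avoiding avoids (push _ r) = sorts-avoiding avoids r
  sorts-avoiding avoids (pop {inp = inp} b r) = ⊥-elim (avoids (contains-ʳ++ inp (here (sameOrder b))))

  -- The first premature pop would output `s` next, whereas the head of `inp ʳ++ stk` is then an
  -- entry still in the input. So all entries are pushed, and each unblocked push keeps the stack
  -- free of `σ`.
  sorts-to-reverse : Unique (inp ʳ++ stk) → AvoidsConsec σ stk →
    Sorts P inp stk o → o ≡ inp ʳ++ stk → AvoidsConsec σ (inp ʳ++ stk)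
  sorts-to-reverse uniq avoids done eq = avoids
  sorts-to-reverse uniq avoids (push {stk = stk} ¬b r) eq = sorts-to-reverse uniq avoids′ r eq
    where
    avoids′ : ¬ ContainsConsec σ (_ ∷ stk)
    avoids′ c with contains-∷⁻ stk c
    ... | inj₁ b  = ¬b b
    ... | inj₂ c′ = avoids c′
  sorts-to-reverse uniq avoids (pop {x} {s} {inp = inp} _ _) eq =
    ⊥-elim (Unique-head (Unique-resp-↭ (↭-trans (ʳ++-↭ (x ∷ inp)) (shift s (x ∷ inp) _)) uniq)
      (∈-++⁺ˡ (head-∈-ʳ++ inp eq)))

  -- The arbitrary tail `u` absorbs the letters before the occurrence, so the induction needs no
  -- separate treatment of them.
  contains-reverse : ∀ w → ContainsConsec (rev σ) w → ContainsConsec σ (w ʳ++ u)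
  contains-reverse (x ∷ y ∷ z ∷ w) (here eq) =
    contains-ʳ++ w (here (SameOrder-reverse (x ∷ y ∷ z ∷ []) (rev σ) eq))
  contains-reverse (x ∷ w@(_ ∷ _ ∷ _)) (there c) = contains-reverse w c

-- Improvement of words read outwards from a fixed entry

-- For fixed `c`, `D-trans` and `D-asym` make the replacement of `a` by `b` a strict order. `D-flip`
-- lets one premature pop count as an improvement in either reading direction. `Q` bounds the
-- entries on one side by `m`, which is what `¬D-m` rests on.
record Straddling (P : ℕ → ℕ → ℕ → Set) (Q : ℕ → Set) (m : ℕ) : Set₁ where
  field
    -- D c a b: a is straddled by c and b.
    D       : ℕ → ℕ → ℕ → Set
    D-flip  : D c a b → D b a c
    D-trans : D c a b → D c b d → D c a d
    D-asym  : D c a b → ¬ D c b a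
    P⇒D     : P x s t → D x s t
    ¬D-m    : Q x → Q y → ¬ D x m y

  -- w′ improves w or equals it, where c is the entry preceding both words.
  data Lex : ℕ → List ℕ → List ℕ → Set where
    end     : Lex c [] w′
    improve : D c a b → Lex c (a ∷ w) (b ∷ w′)
    keep    : Lex a w w′ → Lex c (a ∷ w) (a ∷ w′)

  Lex-refl : ∀ w → Lex c w w
  Lex-refl []      = end
  Lex-refl (a ∷ w) = keep (Lex-refl w)

  Lex-trans : Lex c w w′ → Lex c w′ w″ → Lex c w w″
  Lex-trans end         _            = end
  Lex-trans (improve d) (improve d′) = improve (D-trans d d′)
  Lex-trans (improve d) (keep _)     = improve d
  Lex-trans (keep _)    (improve d)  = improve d
  Lex-trans (keep l)    (keep l′)    = keep (Lex-trans l l′)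

  Lex-antisym : Lex c w w′ → Lex c w′ w → w ≡ w′
  Lex-antisym end         end          = refl
  Lex-antisym (improve d) (improve d′) = ⊥-elim (D-asym d d′)
  Lex-antisym (improve d) (keep _)     = ⊥-elim (D-asym d d)
  Lex-antisym (keep _)    (improve d)  = ⊥-elim (D-asym d d)
  Lex-antisym (keep l)    (keep l′)    = cong (_ ∷_) (Lex-antisym l l′)

  Lex-++ : ∀ u → Lex c w w′ → Lex c w (w′ ++ u)
  Lex-++ u end         = end
  Lex-++ u (improve d) = improve d
  Lex-++ u (keep l)    = keep (Lex-++ u l)

  head-or-m : List ℕ → ℕ
  head-or-m []      = m
  head-or-m (x ∷ _) = x

  -- The common prefix is `xs` reversed, so the entry before the first difference is the head of
  -- `xs`, or `m` if `xs` is empty.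
  Lex-ʳ++ : ∀ xs → Lex (head-or-m xs) w w′ → Lex m (xs ʳ++ w) (xs ʳ++ w′)
  Lex-ʳ++ []       l = l
  Lex-ʳ++ (x ∷ xs) l = Lex-ʳ++ xs (keep l)

  -- A popped entry comes earliest in the output, hence farthest from `m`; `Lex` allows such
  -- extensions because `end` accepts any continuation.
  Lex-reverse-∷ : ∀ s u → Lex m w (reverse u) → Lex m w (reverse (s ∷ u))
  Lex-reverse-∷ s u l = subst (Lex m _) (sym (unfold-reverse s u)) (Lex-++ [ s ] l)

  -- Once `m` is stacked, it shields `B` until the end. Outwards from `m`, the right part of the
  -- word is the stack above `m` from bottom to top, then the input: `ys ʳ++ inp`. Each premature
  -- pop improves it.
  sorts-above-m : ∀ ys B → All Q inp → All Q B → Sorts P inp stk o → stk ≡ ys ++ m ∷ B →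
    ∃[ K ] o ≡ K ++ m ∷ B × Lex m (ys ʳ++ inp) (reverse K)
  sorts-above-m ys B qinp qB done eq = ys , eq , Lex-refl (reverse ys)
  sorts-above-m ys B (_ ∷ qinp) qB (push {x} _ r) eq =
    sorts-above-m (x ∷ ys) B qinp qB r (cong (x ∷_) eq)
  -- Popping `m` prematurely would straddle it by `x` and `t`.
  sorts-above-m [] (t ∷ B) (qx ∷ _) (qt ∷ _) (pop b _) refl = ⊥-elim (¬D-m qx qt (P⇒D b))
  -- After `m`, the entry `s` gives way to `x`. The outward reading meets `x` last, opposite to the
  -- order in `P`, hence `D-flip`.
  sorts-above-m (s ∷ []) B qinp qB (pop b r) refl
    with sorts-above-m [] B qinp qB r refl
  ... | K , refl , l =
    s ∷ K , refl , Lex-reverse-∷ s K (Lex-trans (improve (D-flip (P⇒D b))) l)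
  sorts-above-m (s ∷ ys@(_ ∷ _)) B qinp qB (pop b r) refl
    with sorts-above-m ys B qinp qB r refl
  ... | K , refl , l =
    s ∷ K , refl ,
    Lex-reverse-∷ s K (Lex-trans (Lex-ʳ++ ys (improve (D-flip (P⇒D b)))) l)

  -- While `m` waits in the input, the left part read outwards is `L` reversed and then the stack
  -- from the top. It ends up below `m`, hence right of `m` in the output, so the two sides are
  -- exchanged.
  sorts-past-m : ∀ L R → All Q R → All Q L → All Q stk → Sorts P inp stk o → inp ≡ L ++ m ∷ R →
    ∃₂ λ K B → o ≡ K ++ m ∷ B × Lex m (L ʳ++ stk) B × Lex m R (reverse K)
  sorts-past-m [] R qR qL qstk (push {stk = stk} _ r) refl
    with sorts-above-m [] stk qR qstk r refl
  ... | K , eq , l = K , stk , eq , Lex-refl stk , l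
  sorts-past-m (x ∷ L) R qR (qx ∷ qL) qstk (push _ r) refl =
    sorts-past-m L R qR qL (qx ∷ qstk) r refl
  sorts-past-m [] R qR qL (_ ∷ qstk) (pop {s = s} b r) refl
    with sorts-past-m [] R qR qL qstk r refl
  ... | K , B , refl , lL , lR =
    s ∷ K , B , refl , Lex-trans (improve (P⇒D b)) lL , Lex-reverse-∷ s K lR
  sorts-past-m (x ∷ L) R qR qL (_ ∷ qstk) (pop {s = s} b r) refl
    with sorts-past-m (x ∷ L) R qR qL qstk r refl
  ... | K , B , refl , lL , lR =
    s ∷ K , B , refl , Lex-trans (Lex-ʳ++ (x ∷ L) (improve (P⇒D b))) lL , Lex-reverse-∷ s K lR

-- Iteration and cycles.

module _ {A : Set} (f : A → A) where

  iter-shift : ∀ k x → iter f k (f x) ≡ f (iter f k x)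
  iter-shift zero    x = refl
  iter-shift (suc k) x = cong f (iter-shift k x)

  iter-twice : ∀ k x → iter (f ∘ f) k x ≡ iter f k (iter f k x)
  iter-twice zero    x = refl
  iter-twice (suc k) x = cong f (trans (cong f (iter-twice k x)) (sym (iter-shift k (iter f k x))))

  Periodic-step : ∀ {x} → Periodic f x → Periodic f (f x)
  Periodic-step {x} (t , 1≤t , eq) = t , 1≤t , trans (iter-shift t x) (cong f eq)

module Cycle {P : ℕ → ℕ → ℕ → Set} {Q : ℕ → Set} {m : ℕ} (S : Straddling P Q m)
  (f : List ℕ → List ℕ) (f-sorts : ∀ π → Sorts P π [] (f π)) where
  open Straddling S

  f-improves : ∀ U V → All Q (U ʳ++ m ∷ V) →
    ∃₂ λ U′ V′ → f (U ʳ++ m ∷ V) ≡ U′ ʳ++ m ∷ V′ × Lex m U V′ × Lex m V U′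
  f-improves U V qπ
    with subst (All Q) (ʳ++-defn U) qπ
  ... | qπ′ with All.++⁻ (reverse U) qπ′
  ...   | qU , _ ∷ qV
    with sorts-past-m (reverse U) V qV qU [] (f-sorts (U ʳ++ m ∷ V)) (ʳ++-defn U)
  ...     | K , B , eq , lU , lV =
    reverse K , B ,
    trans eq (sym (trans (ʳ++-defn (reverse K)) (cong (_++ m ∷ B) (reverse-involutive K)))) ,
    subst (λ w → Lex m w B) (reverse-involutive U) lU , lV

  f-All : ∀ w → All Q w → f w ≡ w′ → All Q w′
  f-All w qw eq = subst (All Q) eq (All-resp-↭ (↭-sym (map-↭ f f-sorts w)) qw)

  -- Since `f` exchanges the sides, only `f ∘ f` compares a side with itself. The word after one
  -- step is kept inside each chain, so that a closed cycle determines it.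
  orbit-improves : ∀ k U V → All Q (U ʳ++ m ∷ V) →
    ∃₂ λ U₁ V₁ → ∃₂ λ U′ V′ → f (U ʳ++ m ∷ V) ≡ U₁ ʳ++ m ∷ V₁ ×
      iter (f ∘ f) (suc k) (U ʳ++ m ∷ V) ≡ U′ ʳ++ m ∷ V′ ×
      (Lex m U V₁ × Lex m V₁ U′) × (Lex m V U₁ × Lex m U₁ V′)
  orbit-improves k U V qπ with f-improves U V qπ
  ... | U₁ , V₁ , eq₁ , u₁ , v₁ with f-All (U ʳ++ m ∷ V) qπ eq₁
  ...   | qπ₁ with f-improves U₁ V₁ qπ₁ | k
  ...     | U₂ , V₂ , eq₂ , u₂ , v₂ | zero =
    U₁ , V₁ , U₂ , V₂ , eq₁ , trans (cong (f) eq₁) eq₂ , (u₁ , v₂) , (v₁ , u₂)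
  ...     | U₂ , V₂ , eq₂ , u₂ , v₂ | suc k
    with orbit-improves k U₂ V₂ (f-All (U₁ ʳ++ m ∷ V₁) qπ₁ eq₂)
  ...       | _ , _ , U′ , V′ , _ , eq′ , (u₃ , u₄) , (v₃ , v₄) =
    U₁ , V₁ , U′ , V′ , eq₁ ,
    trans (sym (iter-shift (f ∘ f) (suc k) (U ʳ++ m ∷ V)))
      (trans (cong (iter (f ∘ f) (suc k)) (trans (cong (f) eq₁) eq₂)) eq′) ,
    (u₁ , Lex-trans v₂ (Lex-trans u₃ u₄)) , (v₁ , Lex-trans u₂ (Lex-trans v₃ v₄))

  cycle⇒f≡reverse : ∀ k U V → Unique (U ʳ++ m ∷ V) → All Q (U ʳ++ m ∷ V) →
    iter (f ∘ f) (suc k) (U ʳ++ m ∷ V) ≡ U ʳ++ m ∷ V →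
    f (U ʳ++ m ∷ V) ≡ reverse (U ʳ++ m ∷ V)
  cycle⇒f≡reverse k U V uniq qπ cycle with orbit-improves k U V qπ
  ... | U₁ , V₁ , U′ , V′ , eq₁ , eq′ , (u , u′) , (v , v′)
    with ʳ++-∷-unique U U′ uniq (trans (sym cycle) eq′)
  -- Now `U′` is `U` and `V′` is `V`, so the chains close up and force `V₁ ≡ U` and `U₁ ≡ V`.
  ...   | refl , refl with Lex-antisym u u′ | Lex-antisym v v′
  ...     | refl | refl = trans eq₁ (sym (reverse-ʳ++-∷ U V))

  periodic⇒f≡reverse : ∀ {π} → Unique π → All Q π → m ∈ π →
    Periodic (f) π → f π ≡ reverse π
  periodic⇒f≡reverse {π} uniq qπ m∈π (suc k , _ , cycle) with ∈-∃++ m∈π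
  ... | L , R , refl =
    subst (λ w → f w ≡ reverse w) π≡
      (cycle⇒f≡reverse k (reverse L) R (subst Unique (sym π≡) uniq) (subst (All Q) (sym π≡) qπ)
        -- Going round the cycle twice gives `suc k` steps of `f ∘ f`, whatever the parity of the
        -- period.
        (subst (λ w → iter (f ∘ f) (suc k) w ≡ w) (sym π≡)
          (trans (iter-twice (f) (suc k) π) (trans (cong (iter (f) (suc k)) cycle) cycle))))
    where
    π≡ : reverse L ʳ++ m ∷ R ≡ L ++ m ∷ R
    π≡ = trans (ʳ++-defn (reverse L)) (cong (_++ m ∷ R) (reverse-involutive L))

-- The three kinds of pattern of length 3

module Orders (p q r : ℕ) where
  open Pattern p q r

  module _ (pat : P x s t) where

    private
      triple : List ℕ
      triple = x ∷ s ∷ t ∷ []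

      ranks : rank triple x ≡ rank σ p × rank triple s ≡ rank σ q × rank triple t ≡ rank σ r
      ranks = map-triple-≡ (rank triple) (rank σ) (sameOrder pat)

    p<q⇒x<s : p < q → x < s
    p<q⇒x<s = rank-≡-reflects-< triple σ (proj₁ ranks) (proj₁ (proj₂ ranks)) (there (here refl))

    q<p⇒s<x : q < p → s < x
    q<p⇒s<x = rank-≡-reflects-< triple σ (proj₁ (proj₂ ranks)) (proj₁ ranks) (here refl)

    q<r⇒s<t : q < r → s < t
    q<r⇒s<t = rank-≡-reflects-< triple σ (proj₁ (proj₂ ranks)) (proj₂ (proj₂ ranks))
      (there (there (here refl)))

    r<q⇒t<s : r < q → t < s
    r<q⇒t<s = rank-≡-reflects-< triple σ (proj₂ (proj₂ ranks)) (proj₁ (proj₂ ranks))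
      (there (here refl))

  peak : p < q → r < q → ∀ m → Straddling P (m ≤_) m
  peak p<q r<q m = record
    { D       = λ c a b → c < a × b < a
    ; D-flip  = λ (ca , ba) → ba , ca
    ; D-trans = λ (ca , ba) (_ , db) → ca , <-trans db ba
    ; D-asym  = λ (_ , ba) (_ , ab) → <-asym ba ab
    ; P⇒D     = λ pat → p<q⇒x<s pat p<q , r<q⇒t<s pat r<q
    ; ¬D-m    = λ m≤x _ (x<m , _) → <⇒≱ x<m m≤x
    }

  valley : q < p → q < r → ∀ m → Straddling P (_≤ m) m
  valley q<p q<r m = record
    { D       = λ c a b → a < c × a < b
    ; D-flip  = λ (ac , ab) → ab , ac
    ; D-trans = λ (ac , ab) (_ , bd) → ac , <-trans ab bd
    ; D-asym  = λ (_ , ab) (_ , ba) → <-asym ab ba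
    ; P⇒D     = λ pat → q<p⇒s<x pat q<p , q<r⇒s<t pat q<r
    ; ¬D-m    = λ x≤m _ (m<x , _) → <⇒≱ m<x x≤m
    }

  -- Reversal exchanges the increasing and the decreasing pattern, so `D` has to admit both for
  -- `D-flip` to hold.
  between : (p < q × q < r) ⊎ (r < q × q < p) → ∀ m → Straddling P (m ≤_) m
  between pqr m = record
    { D       = λ c a b → (c < a × a < b) ⊎ (b < a × a < c)
    ; D-flip  = λ where
        (inj₁ d) → inj₂ d
        (inj₂ d) → inj₁ d
    ; D-trans = λ where
        (inj₁ (ca , ab)) (inj₁ (_ , bd))  → inj₁ (ca , <-trans ab bd)
        -- The mixed cases are void: the first relation already fixes on which side of `c` the entry
        -- `b` lies.
        (inj₁ (ca , ab)) (inj₂ (_ , bc))  → ⊥-elim (<-asym (<-trans ca ab) bc)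
        (inj₂ (ba , ac)) (inj₁ (cb , _))  → ⊥-elim (<-asym (<-trans ba ac) cb)
        (inj₂ (ba , ac)) (inj₂ (db , _))  → inj₂ (<-trans db ba , ac)
    ; D-asym  = λ where
        (inj₁ (_ , ab)) (inj₁ (_ , ba))  → <-asym ab ba
        (inj₁ (ca , _)) (inj₂ (ab , bc)) → <-asym ca (<-trans ab bc)
        (inj₂ (_ , ac)) (inj₁ (cb , ba)) → <-asym ac (<-trans cb ba)
        (inj₂ (ba , _)) (inj₂ (ab , _))  → <-asym ba ab
    ; P⇒D     = λ pat → P⇒between pat pqr
    ; ¬D-m    = λ where
        m≤x _ (inj₁ (x<m , _)) → <⇒≱ x<m m≤x
        _ m≤y (inj₂ (y<m , _)) → <⇒≱ y<m m≤y
    }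
    where
    P⇒between : P x s t → (p < q × q < r) ⊎ (r < q × q < p) → (x < s × s < t) ⊎ (t < s × s < x)
    P⇒between pat (inj₁ (p<q , q<r)) = inj₁ (p<q⇒x<s pat p<q , q<r⇒s<t pat q<r)
    P⇒between pat (inj₂ (r<q , q<p)) = inj₂ (r<q⇒t<s pat r<q , q<p⇒s<x pat q<p)

-- Permutations and their periodic points.

IsPerm-Unique : IsPerm n w → Unique w
IsPerm-Unique {n} perm =
  Unique-resp-↭ (↭-sym perm) (Unique.map⁺ suc-injective (Unique.upTo⁺ n))

IsPerm-≥1 : IsPerm n w → All (1 ≤_) w
IsPerm-≥1 {n} perm = All-resp-↭ (↭-sym perm) (All.map⁺ (tabulate λ _ → s≤s z≤n))

IsPerm-≤n : IsPerm n w → All (_≤ n) w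
IsPerm-≤n {n} perm = All-resp-↭ (↭-sym perm) (All.map⁺ (All.all-upTo n))

IsPerm-∈ : ∀ {i} → i < n → IsPerm n w → suc i ∈ w
IsPerm-∈ i<n perm = ∈-resp-↭ (↭-sym perm) (∈-map⁺ suc (∈-upTo⁺ i<n))

IsPerm-length : IsPerm n w → length w ≡ n
IsPerm-length {n} perm = trans (↭-length perm) (trans (length-map suc (upTo n)) (length-upTo n))

reverse≢id : Unique w → 2 ≤ length w → reverse w ≢ w
reverse≢id {a ∷ b ∷ w} uniq _ eq = Unique-head uniq (head-∈-ʳ++ w (sym eq))
reverse≢id {_ ∷ []} _ (s≤s ()) _

module Dynamics (p q r : ℕ) (p≢q : p ≢ q) (q≢r : q ≢ r)
  (f : List ℕ → List ℕ) (f-sorts : ∀ π → Sorts (Pattern.P p q r) π [] (f π)) where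
  open Pattern p q r
  open Orders p q r

  -- If the middle entry of `σ` exceeds a neighbour, straddled entries do too, so the minimum `1` is
  -- never straddled. If it is the smallest, the maximum `n` serves instead.
  extreme-straddling : 1 ≤ n →
    ∃₂ λ Q m → Straddling P Q m × (∀ {w} → IsPerm n w → All Q w × m ∈ w)
  extreme-straddling {suc k} _ with <-cmp p q | <-cmp q r
  ... | tri≈ _ p≡q _ | _ = contradiction p≡q p≢q
  ... | _ | tri≈ _ q≡r _ = contradiction q≡r q≢r
  ... | tri< p<q _ _ | tri> _ _ r<q =
    _ , 1 , peak p<q r<q 1 , λ perm → IsPerm-≥1 perm , IsPerm-∈ (s≤s z≤n) perm
  ... | tri> _ _ q<p | tri< q<r _ _ =
    _ , suc k , valley q<p q<r (suc k) , λ perm → IsPerm-≤n perm , IsPerm-∈ ≤-refl perm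
  ... | tri< p<q _ _ | tri< q<r _ _ =
    _ , 1 , between (inj₁ (p<q , q<r)) 1 , λ perm → IsPerm-≥1 perm , IsPerm-∈ (s≤s z≤n) perm
  ... | tri> _ _ q<p | tri> _ _ r<q =
    _ , 1 , between (inj₂ (r<q , q<p)) 1 , λ perm → IsPerm-≥1 perm , IsPerm-∈ (s≤s z≤n) perm

  periodic⇒f≡reverse : 1 ≤ n → IsPerm n w → Periodic f w → f w ≡ reverse w
  periodic⇒f≡reverse 1≤n perm periodic =
    let _ , _ , S , entries = extreme-straddling 1≤n
        qw , m∈w            = entries perm
    in Cycle.periodic⇒f≡reverse S f f-sorts (IsPerm-Unique perm) qw m∈w periodic

  avoids⇒f≡reverse : ∀ w → AvoidsConsec σ (reverse w) → f w ≡ reverse w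
  avoids⇒f≡reverse w avoids = sorts-avoiding avoids (f-sorts w)

  periodic⇒avoids : 1 ≤ n → IsPerm n w → Periodic f w → AvoidsConsec σ (reverse w)
  periodic⇒avoids {w = w} 1≤n perm periodic =
    sorts-to-reverse (Unique-resp-↭ (↭-sym (↭-reverse w)) (IsPerm-Unique perm)) (λ ())
      (f-sorts w) (periodic⇒f≡reverse 1≤n perm periodic)

  avoids⇒f²≡id : ∀ w → AvoidsConsec σ w → AvoidsConsec (rev σ) w → f (f w) ≡ w
  avoids⇒f²≡id w avoids avoidsʳ = trans
    (cong f (avoids⇒f≡reverse w (avoidsʳ ∘ reversed)))
    (trans (avoids⇒f≡reverse (reverse w)
        (avoids ∘ subst (ContainsConsec σ) (reverse-involutive w)))
      (reverse-involutive w))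
    where
    reversed : ContainsConsec σ (reverse w) → ContainsConsec (rev σ) w
    reversed c = subst (ContainsConsec (rev σ)) (reverse-involutive w)
      -- The pattern is taken to be `rev σ`, whose own reverse is `σ`.
      (Pattern.contains-reverse r q p (reverse w) c)

  periodic⇔avoids : 1 ≤ n → ∀ w → IsPerm n w →
    Periodic f w ⇔ (AvoidsConsec σ w × AvoidsConsec (rev σ) w)
  periodic⇔avoids 1≤n w perm = mk⇔
    (λ periodic →
      -- The next point `f w` of the cycle is also periodic, and its reverse is `w`; this gives
      -- avoidance of `σ`, while `w` itself gives avoidance of `rev σ`.
      subst (AvoidsConsec σ)
        (trans (cong reverse (periodic⇒f≡reverse 1≤n perm periodic)) (reverse-involutive w))
        (periodic⇒avoids 1≤n (↭-trans (map-↭ f f-sorts w) perm) (Periodic-step f periodic)) ,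
      periodic⇒avoids 1≤n perm periodic ∘ contains-reverse w)
    (λ (avoids , avoidsʳ) → 2 , s≤s z≤n , avoids⇒f²≡id w avoids avoidsʳ)

  periodic⇒period2 : 2 ≤ n → ∀ w → IsPerm n w → Periodic f w → HasPeriod f w 2
  periodic⇒period2 {n} 2≤n w perm periodic =
    s≤s z≤n , avoids⇒f²≡id w (proj₁ avoids) (proj₂ avoids) , minimal
    where
    1≤n : 1 ≤ n
    1≤n = ≤-trans (s≤s z≤n) 2≤n

    avoids : AvoidsConsec σ w × AvoidsConsec (rev σ) w
    avoids = Equivalence.to (periodic⇔avoids 1≤n w perm) periodic

    minimal : ∀ t → 1 ≤ t → t < 2 → iter f t w ≢ w
    minimal 1 _ _ eq = reverse≢id (IsPerm-Unique perm)
      (subst (2 ≤_) (sym (IsPerm-length perm)) 2≤n)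
      (trans (sym (periodic⇒f≡reverse 1≤n perm periodic)) eq)
    minimal (suc (suc _)) _ (s≤s (s≤s ())) _

length-3 : length w ≡ 3 → ∃[ p ] ∃[ q ] ∃[ r ] w ≡ p ∷ q ∷ r ∷ []
length-3 {p ∷ q ∷ r ∷ []} refl = p , q , r , refl

theorem3p1 : (σ : List ℕ) → IsPerm 3 σ → (n : ℕ) → 1 ≤ n →
    ((π : List ℕ) → IsPerm n π →
    Periodic (SC σ) π ⇔ (AvoidsConsec σ π × AvoidsConsec (rev σ) π))
    × (2 ≤ n → (π : List ℕ) → IsPerm n π → Periodic (SC σ) π → HasPeriod (SC σ) π 2)
theorem3p1 σ permσ n 1≤n with length-3 {σ} (IsPerm-length permσ)
... | p , q , r , refl with IsPerm-Unique permσ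
...   | (p≢q ∷ _) ∷ (q≢r ∷ _) ∷ _ = periodic⇔avoids 1≤n , periodic⇒period2
  where open Dynamics p q r p≢q q≢r (SC (p ∷ q ∷ r ∷ [])) (Pattern.SC-sorts p q r)
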